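{- (1) Let $(A,\wedge,\vee,\to,\top,\bot,\mathsf p,\mathsf p^*,1)$ be a Heyting algebra with a closure operator $\mathsf p$, residual $\mathsf p^*$ of $\mathsf p$, and constant $1$ such that for all $x,y\in A$: $\mathsf p x\wedge\mathsf p y\le\mathsf p((\mathsf p x\wedge y)\vee(x\wedge\mathsf p y))$, $\mathsf p1=\top$ and $\mathsf p x\wedge1\le x$. If we define $x*y=(\mathsf p x\wedge y)\vee(x\wedge\mathsf p y)$ and $x\mathbin{ -\!\!*}y=(\mathsf p x\to y)\wedge\mathsf p^*(x\to y)$, then $(A,\wedge,\vee,\to,\top,\bot,*,\mathbin{ -\!\!*},1)$ is a unary-determined BI-algebra, and $(x*\top)\wedge(y*\top)\le(((x*\top)\wedge y)\vee(x\wedge(y*\top)))*\top$ holds for all $x,y\in A$. (2) Let $(A,\wedge,\vee,\to,\top,\bot,*,\mathbin{ -\!\!*},1)$ be a unary-determined BI-algebra and define $\mathsf p x=x*\top$ and $\mathsf p^*x=\top\mathbin{ -\!\!*}x$. Then $(A,\wedge,\vee,\to,\top,\bot,\mathsf p,\mathsf p^*,1)$ is a Heyting algebra with a closure operator $\mathsf p$ that has $\mathsf p^*$ as residual and satisfies $\mathsf p x\wedge\mathsf p y\le\mathsf p((\mathsf p x\wedge y)\vee(x\wedge\mathsf p y))$, $\mathsf p1=\top$ and $\mathsf p x\wedge1\le x$ for all $x,y\in A$.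
   Context: A Heyting algebra $(A,\wedge,\vee,\to,\top,\bot)$ is a bounded lattice with $x\wedge y\le z\iff y\le x\to z$. A closure operator is an order-preserving unary operation $\mathsf p$ with $x\le\mathsf p x=\mathsf p\mathsf p x$ for all $x$. A residual of $\mathsf p$ is a unary operation $\mathsf p^*$ with $\mathsf p x\le y\iff x\le\mathsf p^*y$ for all $x,y$. A BI-algebra (bunched implication algebra) is an algebra $(A,\wedge,\vee,\to,\top,\bot,*,\mathbin{ -\!\!*},1)$ such that $(A,\wedge,\vee,\to,\top,\bot)$ is a Heyting algebra, $(A,*,1)$ is a commutative monoid, and $x*y\le z\iff y\le x\mathbin{ -\!\!*}z$ for all $x,y,z$. It is unary-determined if $x*y=((x*\top)\wedge y)\vee(x\wedge(\top*y))$ for all $x,y$. -}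

module Defs where

open import Algebra.Core using (Op₁; Op₂)
open import Algebra.Definitions using (IdempotentFun)
open import Algebra.Structures using (IsCommutativeMonoid)
open import Level using (Level; _⊔_)
open import Relation.Binary.Core using (Rel)
open import Relation.Binary.Definitions using (Adjoint; Monotonic₁)
open import Relation.Binary.Lattice.Structures using (IsHeytingAlgebra)

-- Equality is the setoid equality _≈_ with respect to which _≤_ is
-- antisymmetric.  No congruence of p is required separately: it follows from
-- monotonicity.

module _ {c ℓ₁ ℓ₂ : Level} {A : Set c} (_≈_ : Rel A ℓ₁) (_≤_ : Rel A ℓ₂) where

  record IsClosureOperator (p : Op₁ A) : Set (c ⊔ ℓ₁ ⊔ ℓ₂) where
    field
      monotone   : Monotonic₁ _≤_ _≤_ p
      extensive  : ∀ x → x ≤ p x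
      idempotent : IdempotentFun _≈_ p

  record IsClosureHeytingAlgebra
    (_∨_ _∧_ _⇨_ : Op₂ A) (⊤ ⊥ : A) (p p* : Op₁ A) (𝟏 : A) : Set (c ⊔ ℓ₁ ⊔ ℓ₂) where
    field
      isHeytingAlgebra  : IsHeytingAlgebra _≈_ _≤_ _∨_ _∧_ _⇨_ ⊤ ⊥
      isClosureOperator : IsClosureOperator p
      residual          : Adjoint _≤_ _≤_ p p*
      p-∧-≤             : ∀ x y → (p x ∧ p y) ≤ p ((p x ∧ y) ∨ (x ∧ p y))
      p-𝟏               : p 𝟏 ≈ ⊤
      p-∧-𝟏             : ∀ x → (p x ∧ 𝟏) ≤ x

  -- The monoid congruence law for _*_ is part of IsCommutativeMonoid.
  record IsBIAlgebra
    (_∨_ _∧_ _⇨_ : Op₂ A) (⊤ ⊥ : A) (_*_ _-*_ : Op₂ A) (𝟏 : A) : Set (c ⊔ ℓ₁ ⊔ ℓ₂) where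
    field
      isHeytingAlgebra    : IsHeytingAlgebra _≈_ _≤_ _∨_ _∧_ _⇨_ ⊤ ⊥
      isCommutativeMonoid : IsCommutativeMonoid _≈_ _*_ 𝟏
      residual            : ∀ x → Adjoint _≤_ _≤_ (x *_) (x -*_)

  record IsUnaryDeterminedBIAlgebra
    (_∨_ _∧_ _⇨_ : Op₂ A) (⊤ ⊥ : A) (_*_ _-*_ : Op₂ A) (𝟏 : A) : Set (c ⊔ ℓ₁ ⊔ ℓ₂) where
    field
      isBIAlgebra     : IsBIAlgebra _∨_ _∧_ _⇨_ ⊤ ⊥ _*_ _-*_ 𝟏
      unaryDetermined : ∀ x y → (x * y) ≈ (((x * ⊤) ∧ y) ∨ (x ∧ (⊤ * y)))

{-# OPTIONS --safe #-}
module Submission where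

open import Defs
open import Algebra.Core using (Op₁; Op₂)
open import Algebra.Definitions using (Associative; Commutative; Congruent₂; LeftIdentity)
open import Algebra.Consequences.Setoid using (comm∧idˡ⇒id)
open import Algebra.Structures using (IsCommutativeMonoid)
open import Data.Product.Base using (_×_; _,_; proj₁; proj₂)
open import Level using (Level)
open import Relation.Binary.Core using (Rel)
open import Relation.Binary.Definitions using (Adjoint)
open import Relation.Binary.Lattice.Bundles using (HeytingAlgebra)
import Relation.Binary.Lattice.Properties.BoundedMeetSemilattice as BoundedMeet
import Relation.Binary.Lattice.Properties.HeytingAlgebra as Heyting
import Relation.Binary.Lattice.Properties.JoinSemilattice as Join
import Relation.Binary.Lattice.Properties.MeetSemilattice as Meet
import Relation.Binary.Reasoning.PartialOrder as ≤-Reasoning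

-- In one direction, associativity of x * y = (p x ∧ y) ∨ (x ∧ p y) rests on
-- p (x * y) = p x ∧ p y: it makes (x * y) * z the join of p x ∧ p y ∧ z,
-- p x ∧ y ∧ p z and x ∧ p y ∧ p z, which is symmetric in x, y, z.  In the other
-- direction, ⊤ * ⊤ = ⊤ gives p x * p y = p (x * y), and unary determination
-- gives p x ∧ p y ≤ p x * p y.

module ClosureToBI {c ℓ₁ ℓ₂ : Level} (H : HeytingAlgebra c ℓ₁ ℓ₂) where
  open HeytingAlgebra H
  open Meet meetSemilattice using (∧-comm; ∧-assoc; ∧-cong; ∧-monotonic)
  open Join joinSemilattice using (∨-comm; ∨-cong)
  open BoundedMeet boundedMeetSemilattice using () renaming (identityˡ to ∧-identityˡ; identityʳ to ∧-identityʳ)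
  open Heyting H using (swap-transpose-⇨)
  open ≤-Reasoning poset

  module _ {p p* : Op₁ Carrier} {𝟏 : Carrier}
           (C : IsClosureHeytingAlgebra _≈_ _≤_ _∨_ _∧_ _⇨_ ⊤ ⊥ p p* 𝟏) where
    open IsClosureHeytingAlgebra C using (isClosureOperator; p-∧-≤; p-𝟏; p-∧-𝟏)
      renaming (residual to p-residual)
    open IsClosureOperator isClosureOperator

    infixl 8 _*_
    infixr 8 _-*_

    _*_ _-*_ : Op₂ Carrier
    x * y = (p x ∧ y) ∨ (x ∧ p y)
    x -* y = (p x ⇨ y) ∧ p* (x ⇨ y)

    p-cong : ∀ {x y} → x ≈ y → p x ≈ p y
    p-cong x≈y = antisym (monotone (reflexive x≈y)) (monotone (reflexive (Eq.sym x≈y)))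

    *-cong : Congruent₂ _≈_ _*_
    *-cong x≈y u≈v = ∨-cong (∧-cong (p-cong x≈y) u≈v) (∧-cong x≈y (p-cong u≈v))

    *-comm : Commutative _≈_ _*_
    *-comm x y = Eq.trans (∨-comm _ _) (∨-cong (∧-comm _ _) (∧-comm _ _))

    -- Each axiom on `𝟏` gives one inequality: `p-∧-𝟏` bounds the disjunct `𝟏 ∧ p x` by `x`, and
    -- `p-𝟏` turns the disjunct `p 𝟏 ∧ x` into `x`.
    *-identityˡ : LeftIdentity _≈_ 𝟏 _*_
    *-identityˡ x = antisym
      (∨-least (x∧y≤y _ _) (trans (reflexive (∧-comm _ _)) (p-∧-𝟏 x)))
      (begin
        x        ≈⟨ ∧-identityˡ x ⟨
        ⊤ ∧ x    ≈⟨ ∧-cong p-𝟏 Eq.refl ⟨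
        p 𝟏 ∧ x  ≤⟨ x≤x∨y _ _ ⟩
        𝟏 * x    ∎)

    -- Both disjuncts of `x * y` lie below `p x` and below `p y`, which are closed. This half holds
    -- for any closure operator; the converse is the axiom `p-∧-≤`.
    p-*-≤ : ∀ x y → p (x * y) ≤ p x ∧ p y
    p-*-≤ x y = ∧-greatest
      (trans (monotone (∨-least (x∧y≤x _ _) (trans (x∧y≤x _ _) (extensive x)))) (reflexive (idempotent x)))
      (trans (monotone (∨-least (trans (x∧y≤y _ _) (extensive y)) (x∧y≤y _ _))) (reflexive (idempotent y)))

    *-assoc-≤ : ∀ x y z → (x * y) * z ≤ x * (y * z)
    *-assoc-≤ x y z = ∨-least
      (begin
        p (x * y) ∧ z    ≤⟨ ∧-monotonic (p-*-≤ x y) refl ⟩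
        (p x ∧ p y) ∧ z  ≈⟨ ∧-assoc _ _ _ ⟩
        p x ∧ (p y ∧ z)  ≤⟨ ∧-monotonic refl (x≤x∨y _ _) ⟩
        p x ∧ (y * z)    ≤⟨ x≤x∨y _ _ ⟩
        x * (y * z)      ∎)
      -- Distributivity through the implication: moving `p z` to the right of `≤` exposes the join
      -- `x * y` for a case split.
      (transpose-∧ (∨-least
        (transpose-⇨ (begin
          (p x ∧ y) ∧ p z  ≈⟨ ∧-assoc _ _ _ ⟩
          p x ∧ (y ∧ p z)  ≤⟨ ∧-monotonic refl (y≤x∨y _ _) ⟩
          p x ∧ (y * z)    ≤⟨ x≤x∨y _ _ ⟩
          x * (y * z)      ∎))
        (transpose-⇨ (begin
          (x ∧ p y) ∧ p z  ≈⟨ ∧-assoc _ _ _ ⟩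
          -- The only case that needs the axiom: neither `y` nor `z` occurs unclosed, so the closure
          -- of `y * z` must absorb `p y ∧ p z`.
          x ∧ (p y ∧ p z)  ≤⟨ ∧-monotonic refl (p-∧-≤ y z) ⟩
          x ∧ p (y * z)    ≤⟨ y≤x∨y _ _ ⟩
          x * (y * z)      ∎))))

    -- Commutativity reverses the bracketed product, so the converse is the same inequality with `x`
    -- and `z` exchanged.
    *-assoc : Associative _≈_ _*_
    *-assoc x y z = antisym (*-assoc-≤ x y z) (begin
      x * (y * z)  ≈⟨ *-comm _ _ ⟩
      (y * z) * x  ≈⟨ *-cong (*-comm y z) Eq.refl ⟩
      (z * y) * x  ≤⟨ *-assoc-≤ z y x ⟩
      z * (y * x)  ≈⟨ *-cong Eq.refl (*-comm y x) ⟩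
      z * (x * y)  ≈⟨ *-comm _ _ ⟩
      (x * y) * z  ∎)

    *-isCommutativeMonoid : IsCommutativeMonoid _≈_ _*_ 𝟏
    *-isCommutativeMonoid = record
      { isMonoid = record
        { isSemigroup = record
          { isMagma = record { isEquivalence = isEquivalence ; ∙-cong = *-cong }
          ; assoc = *-assoc
          }
        ; identity = comm∧idˡ⇒id setoid *-comm *-identityˡ
        }
      ; comm = *-comm
      }

    -- A bound `z` on the join splits into `p x ∧ y ≤ z`, that is `y ≤ p x ⇨ z`, and `x ∧ p y ≤ z`,
    -- that is `p y ≤ x ⇨ z`, or `y ≤ p* (x ⇨ z)`. The meet of the two bounds on `y` is `x -* z`.
    *-residual : ∀ x → Adjoint _≤_ _≤_ (x *_) (x -*_)
    *-residual x =
        (λ x*y≤z → ∧-greatest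
          (swap-transpose-⇨ (trans (x≤x∨y _ _) x*y≤z))
          (proj₁ p-residual (swap-transpose-⇨ (trans (y≤x∨y _ _) x*y≤z))))
      , (λ y≤x-*z → ∨-least
          (trans (reflexive (∧-comm _ _)) (transpose-∧ (trans y≤x-*z (x∧y≤x _ _))))
          (trans (reflexive (∧-comm _ _)) (transpose-∧ (proj₂ p-residual (trans y≤x-*z (x∧y≤y _ _))))))

    -- Recovers `p` from `*`, since the disjunct `x ∧ p ⊤` is absorbed by `x ≤ p x`. Unary
    -- determination then reduces to the definition of `*`, and the final inequality to `p-∧-≤`.
    x*⊤≈px : ∀ x → x * ⊤ ≈ p x
    x*⊤≈px x = antisym
      (∨-least (x∧y≤x _ _) (trans (x∧y≤x _ _) (extensive x)))
      (trans (reflexive (Eq.sym (∧-identityʳ (p x)))) (x≤x∨y _ _))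

    *-unaryDetermined : ∀ x y → x * y ≈ ((x * ⊤) ∧ y) ∨ (x ∧ (⊤ * y))
    *-unaryDetermined x y = Eq.sym (∨-cong
      (∧-cong (x*⊤≈px x) Eq.refl)
      (∧-cong Eq.refl (Eq.trans (*-comm ⊤ y) (x*⊤≈px y))))

    isUnaryDeterminedBIAlgebra : IsUnaryDeterminedBIAlgebra _≈_ _≤_ _∨_ _∧_ _⇨_ ⊤ ⊥ _*_ _-*_ 𝟏
    isUnaryDeterminedBIAlgebra = record
      { isBIAlgebra = record
        { isHeytingAlgebra    = isHeytingAlgebra
        ; isCommutativeMonoid = *-isCommutativeMonoid
        ; residual            = *-residual
        }
      ; unaryDetermined = *-unaryDetermined
      }

    *⊤-∧-≤ : ∀ x y → (x * ⊤) ∧ (y * ⊤) ≤ (((x * ⊤) ∧ y) ∨ (x ∧ (y * ⊤))) * ⊤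
    *⊤-∧-≤ x y = begin
      (x * ⊤) ∧ (y * ⊤)                        ≈⟨ ∧-cong (x*⊤≈px x) (x*⊤≈px y) ⟩
      p x ∧ p y                                ≤⟨ p-∧-≤ x y ⟩
      p (x * y)                                ≈⟨ x*⊤≈px (x * y) ⟨
      (x * y) * ⊤                              ≈⟨ *-cong (∨-cong (∧-cong (x*⊤≈px x) Eq.refl) (∧-cong Eq.refl (x*⊤≈px y))) Eq.refl ⟨
      (((x * ⊤) ∧ y) ∨ (x ∧ (y * ⊤))) * ⊤      ∎

module BIToClosure {c ℓ₁ ℓ₂ : Level} (H : HeytingAlgebra c ℓ₁ ℓ₂) where
  open HeytingAlgebra H
  open Meet meetSemilattice using (∧-cong)
  open Join joinSemilattice using (∨-cong)
  open ≤-Reasoning poset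

  module _ {_*_ _-*_ : Op₂ Carrier} {𝟏 : Carrier}
           (B : IsUnaryDeterminedBIAlgebra _≈_ _≤_ _∨_ _∧_ _⇨_ ⊤ ⊥ _*_ _-*_ 𝟏) where
    open IsUnaryDeterminedBIAlgebra B
    open IsBIAlgebra isBIAlgebra using (isCommutativeMonoid; residual)
    open IsCommutativeMonoid isCommutativeMonoid
      using (identityˡ; identityʳ) renaming (assoc to *-assoc; comm to *-comm; ∙-cong to *-cong)

    -- A left adjoint is monotone, by the unit `z ≤ x -* (x * z)`.
    *-monoʳ : ∀ x {y z} → y ≤ z → (x * y) ≤ (x * z)
    *-monoʳ x y≤z = proj₂ (residual x) (trans y≤z (proj₁ (residual x) refl))

    *-monoˡ : ∀ x {y z} → y ≤ z → (y * x) ≤ (z * x)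
    *-monoˡ x {y} {z} y≤z = begin
      y * x  ≈⟨ *-comm y x ⟩
      x * y  ≤⟨ *-monoʳ x y≤z ⟩
      x * z  ≈⟨ *-comm x z ⟩
      z * x  ∎

    *⊤-extensive : ∀ x → x ≤ (x * ⊤)
    *⊤-extensive x = trans (reflexive (Eq.sym (identityʳ x))) (*-monoʳ x (maximum 𝟏))

    ⊤*⊤≈⊤ : (⊤ * ⊤) ≈ ⊤
    ⊤*⊤≈⊤ = antisym (maximum _) (*⊤-extensive ⊤)

    *⊤-idempotent : ∀ x → ((x * ⊤) * ⊤) ≈ (x * ⊤)
    *⊤-idempotent x = Eq.trans (*-assoc x ⊤ ⊤) (*-cong Eq.refl ⊤*⊤≈⊤)

    -- The two factors `⊤` are brought together and merge into one.
    *⊤-*-*⊤ : ∀ x y → ((x * ⊤) * (y * ⊤)) ≈ ((x * y) * ⊤)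
    *⊤-*-*⊤ x y = begin-equality
      (x * ⊤) * (y * ⊤)  ≈⟨ *-assoc (x * ⊤) y ⊤ ⟨
      ((x * ⊤) * y) * ⊤  ≈⟨ *-cong (*-assoc x ⊤ y) Eq.refl ⟩
      (x * (⊤ * y)) * ⊤  ≈⟨ *-cong (*-cong Eq.refl (*-comm ⊤ y)) Eq.refl ⟩
      (x * (y * ⊤)) * ⊤  ≈⟨ *-cong (*-assoc x y ⊤) Eq.refl ⟨
      ((x * y) * ⊤) * ⊤  ≈⟨ *⊤-idempotent (x * y) ⟩
      (x * y) * ⊤        ∎

    -- The part of unary determination behind two of the axioms: applied to closed elements it leads
    -- to `p-∧-≤`, and at `y = 𝟏`, where `x * 𝟏` is `x`, it gives `p-∧-𝟏`.
    *⊤-∧-≤-* : ∀ x y → ((x * ⊤) ∧ y) ≤ (x * y)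
    *⊤-∧-≤-* x y = trans (x≤x∨y _ _) (reflexive (Eq.sym (unaryDetermined x y)))

    *⊤-∧-≤ : ∀ x y → ((x * ⊤) ∧ (y * ⊤)) ≤ ((((x * ⊤) ∧ y) ∨ (x ∧ (y * ⊤))) * ⊤)
    *⊤-∧-≤ x y = begin
      -- A second `⊤` is inserted so that the next bound applies to `x * ⊤` instead of `x`.
      (x * ⊤) ∧ (y * ⊤)                    ≈⟨ ∧-cong (*⊤-idempotent x) Eq.refl ⟨
      ((x * ⊤) * ⊤) ∧ (y * ⊤)              ≤⟨ *⊤-∧-≤-* (x * ⊤) (y * ⊤) ⟩
      (x * ⊤) * (y * ⊤)                    ≈⟨ *⊤-*-*⊤ x y ⟩
      (x * y) * ⊤                          ≈⟨ *-cong (unaryDetermined x y) Eq.refl ⟩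
      (((x * ⊤) ∧ y) ∨ (x ∧ (⊤ * y))) * ⊤  ≈⟨ *-cong (∨-cong Eq.refl (∧-cong Eq.refl (*-comm ⊤ y))) Eq.refl ⟩
      (((x * ⊤) ∧ y) ∨ (x ∧ (y * ⊤))) * ⊤  ∎

    isClosureHeytingAlgebra :
      IsClosureHeytingAlgebra _≈_ _≤_ _∨_ _∧_ _⇨_ ⊤ ⊥ (_* ⊤) (⊤ -*_) 𝟏
    isClosureHeytingAlgebra = record
      { isHeytingAlgebra  = isHeytingAlgebra
      ; isClosureOperator = record
        { monotone   = *-monoˡ ⊤
        ; extensive  = *⊤-extensive
        ; idempotent = *⊤-idempotent
        }
      ; residual =
            (λ x*⊤≤y → proj₁ (residual ⊤) (trans (reflexive (*-comm _ _)) x*⊤≤y))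
          , (λ x≤⊤-*y → trans (reflexive (*-comm _ _)) (proj₂ (residual ⊤) x≤⊤-*y))
      ; p-∧-≤ = *⊤-∧-≤
      ; p-𝟏   = identityˡ ⊤
      ; p-∧-𝟏 = λ x → trans (*⊤-∧-≤-* x 𝟏) (reflexive (identityʳ x))
      }

corollary3p3 :
    ∀ {c ℓ₁ ℓ₂ : Level} {A : Set c} (_≈_ : Rel A ℓ₁) (_≤_ : Rel A ℓ₂)
      (_∨_ _∧_ _⇨_ : Op₂ A) (⊤ ⊥ 𝟏 : A) →
    ((p p* : Op₁ A) →
      IsClosureHeytingAlgebra _≈_ _≤_ _∨_ _∧_ _⇨_ ⊤ ⊥ p p* 𝟏 →
      let _*_ : Op₂ A
          _*_ = λ x y → (p x ∧ y) ∨ (x ∧ p y)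
          _-*_ : Op₂ A
          _-*_ = λ x y → (p x ⇨ y) ∧ p* (x ⇨ y)
      in  IsUnaryDeterminedBIAlgebra _≈_ _≤_ _∨_ _∧_ _⇨_ ⊤ ⊥ _*_ _-*_ 𝟏
          × (∀ x y → ((x * ⊤) ∧ (y * ⊤)) ≤ ((((x * ⊤) ∧ y) ∨ (x ∧ (y * ⊤))) * ⊤)))
    ×
    ((_*_ _-*_ : Op₂ A) →
      IsUnaryDeterminedBIAlgebra _≈_ _≤_ _∨_ _∧_ _⇨_ ⊤ ⊥ _*_ _-*_ 𝟏 →
      IsClosureHeytingAlgebra _≈_ _≤_ _∨_ _∧_ _⇨_ ⊤ ⊥ (λ x → x * ⊤) (λ x → ⊤ -* x) 𝟏)
corollary3p3 _≈_ _≤_ _∨_ _∧_ _⇨_ ⊤ ⊥ 𝟏 =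
    (λ p p* C → let H = record { isHeytingAlgebra = IsClosureHeytingAlgebra.isHeytingAlgebra C }
                in  ClosureToBI.isUnaryDeterminedBIAlgebra H C , ClosureToBI.*⊤-∧-≤ H C)
  , (λ _*_ _-*_ B → let open IsUnaryDeterminedBIAlgebra B using (isBIAlgebra)
                        H = record { isHeytingAlgebra = IsBIAlgebra.isHeytingAlgebra isBIAlgebra }
                    in  BIToClosure.isClosureHeytingAlgebra H B)
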